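{- Let $n\ge 2$ and $q\ge 2$ be integers, $E_q=\{0,1,\dots,q-1\}$, and let $A\subseteq E_q^n$ be a subset such that $q$ divides $|A|$ and $A$ has uniform column distribution, i.e. for every coordinate $i$ at which the elements of $A$ do not all agree, each value $b\in E_q$ occurs as the $i$-th coordinate of exactly $|A|/q$ elements of $A$. Then $A$ is metrically dense: $R(A)\le R(B)$ for every subset $B\subseteq E_q^n$ that is isometric to $A$.
   Context: $E_q^n$ is the set of all $n$-tuples over $E_q$ with Hamming distance $d_H(x,y)=|\{i: x_i\neq y_i\}|$. For $A\subseteq E_q^n$, $R(A)$ is the number of coordinates $i$ such that the $i$-th coordinates of the elements of $A$ are not all equal (the number of non-constant columns of the matrix whose rows are the elements of $A$). Two subsets $A,B\subseteq E_q^n$ are isometric if there is a bijection $\phi:A\to B$ with $d_H(\phi(x),\phi(y))=d_H(x,y)$ for all $x,y\in A$. -}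

module Defs where

open import Data.Fin using (Fin; _≟_)
open import Data.List using (List; length; filter; allFin)
open import Data.List.Membership.Propositional using (_∈_)
open import Data.List.Relation.Unary.All using (All; all?)
open import Data.List.Relation.Unary.Unique.Propositional using (Unique)
open import Data.Nat using (ℕ; _≤_)
open import Data.Nat.Divisibility using (_∣_; quotient)
open import Data.Product using (Σ-syntax; ∃-syntax; proj₁)
open import Data.Vec using (Vec; lookup)
open import Function.Bundles using (_⤖_; module Bijection)
open import Relation.Binary.PropositionalEquality using (_≡_)
open import Relation.Nullary using (¬_; Dec; ¬?)

-- E_q^n, with E_q = {0, …, q-1} rendered as Fin q.
Word : ℕ → ℕ → Set
Word q n = Vec (Fin q) n

hamming : ∀ {q n} → Word q n → Word q n → ℕ
hamming {n = n} x y = length (filter (λ i → ¬? (lookup x i ≟ lookup y i)) (allFin n))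

-- A subset of the finite set E_q^n, given by an enumeration without
-- repetitions; no notion below depends on the order of the enumeration.
record Code (q n : ℕ) : Set where
  field
    elements : List (Word q n)
    unique   : Unique elements

open Code public

∣_∣ : ∀ {q n} → Code q n → ℕ
∣ A ∣ = length (elements A)

-- Membership proofs in a duplicate-free list are unique, so elements of this
-- type are equal exactly when the underlying words are.
Member : ∀ {q n} → Code q n → Set
Member A = ∃[ x ] x ∈ elements A

ConstantAt : ∀ {q n} → Code q n → Fin n → Set
ConstantAt A i =
  All (λ x → All (λ y → lookup x i ≡ lookup y i) (elements A)) (elements A)

constantAt? : ∀ {q n} (A : Code q n) (i : Fin n) → Dec (ConstantAt A i)
constantAt? A i =
  all? (λ x → all? (λ y → lookup x i ≟ lookup y i) (elements A)) (elements A)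

R : ∀ {q n} → Code q n → ℕ
R {n = n} A = length (filter (λ i → ¬? (constantAt? A i)) (allFin n))

-- The number of elements of A whose i-th coordinate is b.
occurrences : ∀ {q n} → Code q n → Fin n → Fin q → ℕ
occurrences A i b = length (filter (λ x → lookup x i ≟ b) (elements A))

-- quotient q∣A is the number |A|/q.
UniformColumnDistribution : ∀ {q n} (A : Code q n) → q ∣ ∣ A ∣ → Set
UniformColumnDistribution A q∣A =
  ∀ i → ¬ ConstantAt A i → ∀ b → occurrences A i b ≡ quotient q∣A

Isometric : ∀ {q n} → Code q n → Code q n → Set
Isometric A B =
  Σ[ φ ∈ Member A ⤖ Member B ] (let open Bijection φ using (to) in
    ∀ x y → hamming (proj₁ (to x)) (proj₁ (to y)) ≡ hamming (proj₁ x) (proj₁ y))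

MetricallyDense : ∀ {q n} → Code q n → Set
MetricallyDense {q} {n} A = (B : Code q n) → Isometric A B → R A ≤ R B

{-# OPTIONS --safe #-}

-- Count in two ways the sum of the distances over all ordered pairs of elements: column by column,
-- a column whose values b occur c_b times contributes |A|² − Σ c_b².  By AM–GM this is at most
-- K = |A|² − |A|²/q, with equality for a uniformly distributed column, and it is 0 for a constant
-- one.  Hence the sum is R(A) K for A and at most R(B) K for B, while isometric sets have
-- the same sum; finally K > 0 unless A is empty.
module Submission where

open import Defs
open import Data.Fin using (Fin; _≟_)
open import Data.List using (List; []; _∷_; length; map; filter; allFin)
open import Data.List.Membership.Propositional using (_∈_; _∉_; mapWith∈)
open import Data.List.Membership.Propositional.Properties
  using (map-mapWith∈; mapWith∈-id; ∈-map⁺; ∈-map⁻; ∈-allFin)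
open import Data.List.Membership.Propositional.Properties.WithK using (unique⇒irrelevant; unique∧set⇒bag)
open import Data.List.Properties using (length-map; length-tabulate; map-cong; map-∘)
open import Data.List.Relation.Binary.BagAndSetEquality using (∼bag⇒↭)
open import Data.List.Relation.Binary.Permutation.Propositional using (_↭_)
open import Data.List.Relation.Binary.Permutation.Propositional.Properties using (map⁺; ↭-length)
open import Data.List.Relation.Unary.All as All using (All; []; _∷_)
open import Data.List.Relation.Unary.Any using (here; there)
open import Data.List.Relation.Unary.Unique.Propositional using (Unique; []; _∷_)
import Data.List.Relation.Unary.Unique.Propositional.Properties as Unique
open import Data.Nat using (ℕ; zero; suc; _+_; _*_; _∸_; _≤_; _<_; z≤n; z<s; >-nonZero)
open import Data.Nat.Divisibility using (_∣_; divides)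
open import Data.Nat.ListAction using (sum)
open import Data.Nat.ListAction.Properties using (sum-↭)
open import Data.Nat.Properties hiding (_≟_)
open import Data.Nat.Tactic.RingSolver using (solve-∀)
open import Data.Product using (_,_; proj₁; proj₂)
open import Data.Sum using (inj₁; inj₂)
open import Data.Vec using (lookup)
open import Function using (_∘_; mk⇔; module Bijection)
open import Relation.Binary.PropositionalEquality
open import Relation.Nullary using (¬_; Dec; yes; no; ¬?; contradiction)
open import Relation.Unary using (Decidable)

private
  variable
    X Y : Set
    q n : ℕ

-- Finite sums over lists.

∑ : List X → (X → ℕ) → ℕ
∑ xs f = sum (map f xs)

∑-cong : ∀ (xs : List X) {f g : X → ℕ} → f ≗ g → ∑ xs f ≡ ∑ xs g
∑-cong xs f≗g = cong sum (map-cong f≗g xs)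

∑-mono : ∀ (xs : List X) {f g : X → ℕ} → (∀ x → f x ≤ g x) → ∑ xs f ≤ ∑ xs g
∑-mono []       f≤g = z≤n
∑-mono (x ∷ xs) f≤g = +-mono-≤ (f≤g x) (∑-mono xs f≤g)

∑-zero : ∀ {xs : List X} {f : X → ℕ} → All (λ x → f x ≡ 0) xs → ∑ xs f ≡ 0
∑-zero []         = refl
∑-zero (fx≡0 ∷ h) = cong₂ _+_ fx≡0 (∑-zero h)

∑-const : ∀ (xs : List X) c → ∑ xs (λ _ → c) ≡ length xs * c
∑-const []       c = refl
∑-const (x ∷ xs) c = cong (c +_) (∑-const xs c)

∑-distrib-+ : ∀ (xs : List X) (f g : X → ℕ) → ∑ xs (λ x → f x + g x) ≡ ∑ xs f + ∑ xs g
∑-distrib-+ []       f g = refl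
∑-distrib-+ (x ∷ xs) f g = trans (cong (f x + g x +_) (∑-distrib-+ xs f g))
                                 (interchange (f x) (g x) (∑ xs f) (∑ xs g))
  where
  interchange : ∀ a b c d → a + b + (c + d) ≡ a + c + (b + d)
  interchange = solve-∀

∑-distribʳ-* : ∀ (xs : List X) (f : X → ℕ) c → ∑ xs (λ x → f x * c) ≡ ∑ xs f * c
∑-distribʳ-* []       f c = refl
∑-distribʳ-* (x ∷ xs) f c = trans (cong (f x * c +_) (∑-distribʳ-* xs f c))
                                  (sym (*-distribʳ-+ c (f x) (∑ xs f)))

∑-swap : ∀ (xs : List X) (ys : List Y) (f : X → Y → ℕ) →
         ∑ xs (λ x → ∑ ys (f x)) ≡ ∑ ys (λ y → ∑ xs (λ x → f x y))
∑-swap []       ys f = sym (trans (∑-const ys 0) (*-zeroʳ (length ys)))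
∑-swap (x ∷ xs) ys f = trans (cong (∑ ys (f x) +_) (∑-swap xs ys f))
                             (sym (∑-distrib-+ ys (f x) (λ y → ∑ xs (λ x → f x y))))

∑-map : ∀ (h : X → Y) (xs : List X) (f : Y → ℕ) → ∑ (map h xs) f ≡ ∑ xs (f ∘ h)
∑-map h xs f = cong sum (sym (map-∘ xs))

∑-↭ : ∀ {xs ys : List X} (f : X → ℕ) → xs ↭ ys → ∑ xs f ≡ ∑ ys f
∑-↭ f xs↭ys = sum-↭ (map⁺ f xs↭ys)

-- Indicators and sums against a Kronecker delta.

𝟙 : ∀ {P : Set} → Dec P → ℕ
𝟙 (yes _) = 1
𝟙 (no  _) = 0

𝟙-¬ : ∀ {P : Set} (P? : Dec P) → P → 𝟙 (¬? P?) ≡ 0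
𝟙-¬ (yes _) _ = refl
𝟙-¬ (no ¬p) p = contradiction p ¬p

𝟙-¬-+ : ∀ {P : Set} (P? : Dec P) → 𝟙 (¬? P?) + 𝟙 P? ≡ 1
𝟙-¬-+ (yes _) = refl
𝟙-¬-+ (no  _) = refl

length-filter-∑ : ∀ {P : X → Set} (P? : Decidable P) xs → length (filter P? xs) ≡ ∑ xs (λ x → 𝟙 (P? x))
length-filter-∑ P? []       = refl
length-filter-∑ P? (x ∷ xs) with P? x
... | yes _ = cong suc (length-filter-∑ P? xs)
... | no  _ = length-filter-∑ P? xs

∑-δ-∉ : ∀ (f : Fin q → ℕ) {j} xs → j ∉ xs → ∑ xs (λ b → 𝟙 (j ≟ b) * f b) ≡ 0
∑-δ-∉ f []           j∉ = refl
∑-δ-∉ f {j} (b ∷ xs) j∉ with j ≟ b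
... | yes j≡b = contradiction (here j≡b) j∉
... | no  _   = ∑-δ-∉ f xs (j∉ ∘ there)

∑-δ-∈ : ∀ (f : Fin q → ℕ) {j xs} → Unique xs → j ∈ xs → ∑ xs (λ b → 𝟙 (j ≟ b) * f b) ≡ f j
∑-δ-∈ f {j} {b ∷ xs} (b≢ ∷ u) j∈ with j ≟ b
∑-δ-∈ f {xs = b ∷ xs} (b≢ ∷ u) j∈ | yes refl =
  -- `f b + 0` is what `1 * f b` reduces to; the tail adds 0, since by uniqueness it does not
  -- contain `b` again.
  trans (cong (f b + 0 +_) (∑-δ-∉ f xs (Unique.Unique[x∷xs]⇒x∉xs (b≢ ∷ u))))
        (trans (+-identityʳ (f b + 0)) (+-identityʳ (f b)))
∑-δ-∈ f (b≢ ∷ u) (here j≡b)  | no j≢b = contradiction j≡b j≢b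
∑-δ-∈ f (b≢ ∷ u) (there j∈) | no j≢b = ∑-δ-∈ f u j∈

-- Agreeing and disagreeing pairs within one column.

-- This is (c - k)² ≥ 0. To avoid truncated subtraction, the larger number is written as the smaller
-- plus `d`, and the slack is `d * d`. The factor `c` stands in front so that the left side fits
-- `∑-fibres` with a constant function.
2kc≤c²+k² : ∀ k c → c * (2 * k) ≤ c * c + k * k
2kc≤c²+k² k c with ≤-total k c
... | inj₁ k≤c with d , refl ← m≤n⇒∃[o]m+o≡n k≤c =
  subst ((k + d) * (2 * k) ≤_) (eq k d) (m≤m+n _ (d * d))
  where
  eq : ∀ k d → (k + d) * (2 * k) + d * d ≡ (k + d) * (k + d) + k * k
  eq = solve-∀
... | inj₂ c≤k with d , refl ← m≤n⇒∃[o]m+o≡n c≤k =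
  subst (c * (2 * (c + d)) ≤_) (eq c d) (m≤m+n _ (d * d))
  where
  eq : ∀ c d → c * (2 * (c + d)) + d * d ≡ c * c + (c + d) * (c + d)
  eq = solve-∀

module _ (g : X → Fin q) (xs : List X) where

  private m = length xs

  count : Fin q → ℕ
  count b = length (filter (λ x → g x ≟ b) xs)

  agreements disagreements : ℕ
  agreements    = ∑ xs λ x → ∑ xs λ y → 𝟙 (g x ≟ g y)
  disagreements = ∑ xs λ x → ∑ xs λ y → 𝟙 (¬? (g x ≟ g y))

  disagreements+agreements : disagreements + agreements ≡ m * m
  disagreements+agreements = begin
    disagreements + agreements
      ≡⟨ ∑-distrib-+ xs _ _ ⟨
    (∑ xs λ x → (∑ xs λ y → 𝟙 (¬? (g x ≟ g y))) + (∑ xs λ y → 𝟙 (g x ≟ g y)))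
      ≡⟨ ∑-cong xs (λ x → sym (∑-distrib-+ xs _ _)) ⟩
    (∑ xs λ x → ∑ xs λ y → 𝟙 (¬? (g x ≟ g y)) + 𝟙 (g x ≟ g y))
      ≡⟨ ∑-cong xs (λ x → ∑-cong xs λ y → 𝟙-¬-+ (g x ≟ g y)) ⟩
    (∑ xs λ x → ∑ xs λ y → 1)
      ≡⟨ ∑-cong xs (λ x → trans (∑-const xs 1) (*-identityʳ m)) ⟩
    (∑ xs λ x → m)
      ≡⟨ ∑-const xs m ⟩
    m * m ∎
    where open ≡-Reasoning

  disagreements≡m²∸agreements : disagreements ≡ m * m ∸ agreements
  disagreements≡m²∸agreements =
    trans (sym (m+n∸n≡m disagreements agreements)) (cong (_∸ agreements) disagreements+agreements)

  -- Each `f (g x)` is expanded as a delta sum over all values `b`; after exchanging the sums, the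
  -- deltas for a fixed `b` add up to the size of the fibre of `g` over `b`.
  ∑-fibres : ∀ f → ∑ xs (f ∘ g) ≡ ∑ (allFin q) (λ b → count b * f b)
  ∑-fibres f = begin
    ∑ xs (f ∘ g)
      ≡⟨ ∑-cong xs (λ x → sym (∑-δ-∈ f (Unique.allFin⁺ q) (∈-allFin (g x)))) ⟩
    (∑ xs λ x → ∑ (allFin q) λ b → 𝟙 (g x ≟ b) * f b)
      ≡⟨ ∑-swap xs (allFin q) _ ⟩
    (∑ (allFin q) λ b → ∑ xs λ x → 𝟙 (g x ≟ b) * f b)
      ≡⟨ ∑-cong (allFin q) (λ b → trans (∑-distribʳ-* xs _ (f b))
           (cong (_* f b) (sym (length-filter-∑ (λ x → g x ≟ b) xs)))) ⟩
    (∑ (allFin q) λ b → count b * f b) ∎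
    where open ≡-Reasoning

  -- For fixed `y`, the entries agreeing with `y` form the fibre over `g y`, so the double sum is a
  -- sum of `count (g y)`, which is then grouped by fibres.
  agreements≡∑count² : agreements ≡ ∑ (allFin q) (λ b → count b * count b)
  agreements≡∑count² = begin
    agreements                          ≡⟨ ∑-swap xs xs _ ⟩
    (∑ xs λ y → ∑ xs λ x → 𝟙 (g x ≟ g y)) ≡⟨ ∑-cong xs (λ y → sym (length-filter-∑ (λ x → g x ≟ g y) xs)) ⟩
    ∑ xs (count ∘ g)                    ≡⟨ ∑-fibres count ⟩
    ∑ (allFin q) (λ b → count b * count b) ∎
    where open ≡-Reasoning

  ∑-const-allFin : ∀ c → ∑ (allFin q) (λ _ → c) ≡ q * c
  ∑-const-allFin c = trans (∑-const (allFin q) c) (cong (_* c) (length-tabulate {n = q} (λ i → i)))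

  -- Summing 2kc_b ≤ c_b² + k² over b, with Σ c_b = m = kq.
  qk²≤agreements : ∀ k → m ≡ k * q → q * (k * k) ≤ agreements
  qk²≤agreements k m≡kq = +-cancelʳ-≤ (q * (k * k)) _ _ (begin
    q * (k * k) + q * (k * k)
      ≡⟨ double q k ⟩
    k * q * (2 * k)
      ≡⟨ cong (_* (2 * k)) m≡kq ⟨
    m * (2 * k)
      ≡⟨ ∑-const xs (2 * k) ⟨
    ∑ xs (λ _ → 2 * k)
      ≡⟨ ∑-fibres (λ _ → 2 * k) ⟩
    (∑ (allFin q) λ b → count b * (2 * k))
      ≤⟨ ∑-mono (allFin q) (λ b → 2kc≤c²+k² k (count b)) ⟩
    (∑ (allFin q) λ b → count b * count b + k * k)
      ≡⟨ ∑-distrib-+ (allFin q) _ _ ⟩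
    (∑ (allFin q) λ b → count b * count b) + (∑ (allFin q) λ _ → k * k)
      ≡⟨ cong₂ _+_ (sym agreements≡∑count²) (∑-const-allFin (k * k)) ⟩
    agreements + q * (k * k) ∎)
    where
    open ≤-Reasoning
    double : ∀ q k → q * (k * k) + q * (k * k) ≡ k * q * (2 * k)
    double = solve-∀

  disagreements-≤ : ∀ k → m ≡ k * q → disagreements ≤ m * m ∸ q * (k * k)
  disagreements-≤ k m≡kq =
    subst (_≤ m * m ∸ q * (k * k)) (sym disagreements≡m²∸agreements) (∸-monoʳ-≤ (m * m) (qk²≤agreements k m≡kq))

  disagreements-uniform : ∀ k → (∀ b → count b ≡ k) → disagreements ≡ m * m ∸ q * (k * k)
  disagreements-uniform k count≡k = trans disagreements≡m²∸agreements (cong (m * m ∸_) (begin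
    agreements                             ≡⟨ agreements≡∑count² ⟩
    ∑ (allFin q) (λ b → count b * count b) ≡⟨ ∑-cong (allFin q) (λ b → cong₂ _*_ (count≡k b) (count≡k b)) ⟩
    ∑ (allFin q) (λ b → k * k)             ≡⟨ ∑-const-allFin (k * k) ⟩
    q * (k * k)                            ∎))
    where open ≡-Reasoning

  disagreements-constant : All (λ x → All (λ y → g x ≡ g y) xs) xs → disagreements ≡ 0
  disagreements-constant = ∑-zero ∘ All.map (∑-zero ∘ All.map λ {y} → 𝟙-¬ (_ ≟ g y))

-- The distance sum, column by column.

distanceSum : List (Word q n) → ℕ
distanceSum ws = ∑ ws λ x → ∑ ws λ y → hamming x y

-- The Hamming distance is itself a sum of indicators over coordinates; two exchanges move that sum
-- to the outside.
distanceSum-columns : ∀ (ws : List (Word q n)) →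
                      distanceSum ws ≡ ∑ (allFin n) (λ i → disagreements (λ x → lookup x i) ws)
distanceSum-columns {n = n} ws = begin
  distanceSum ws
    ≡⟨ ∑-cong ws (λ x → ∑-cong ws λ y → length-filter-∑ (λ i → ¬? (lookup x i ≟ lookup y i)) (allFin n)) ⟩
  (∑ ws λ x → ∑ ws λ y → ∑ (allFin n) λ i → 𝟙 (¬? (lookup x i ≟ lookup y i)))
    ≡⟨ ∑-cong ws (λ x → ∑-swap ws (allFin n) _) ⟩
  (∑ ws λ x → ∑ (allFin n) λ i → ∑ ws λ y → 𝟙 (¬? (lookup x i ≟ lookup y i)))
    ≡⟨ ∑-swap ws (allFin n) _ ⟩
  ∑ (allFin n) (λ i → disagreements (λ x → lookup x i) ws) ∎
  where open ≡-Reasoning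

-- Spreads `R C * c` over the coordinates, with weight `c` on non-constant columns and 0 on constant
-- ones, so that it can be compared with the distance sum term by term.
R-* : ∀ (C : Code q n) c → R C * c ≡ ∑ (allFin n) (λ i → 𝟙 (¬? (constantAt? C i)) * c)
R-* {n = n} C c = trans (cong (_* c) (length-filter-∑ (λ i → ¬? (constantAt? C i)) (allFin n)))
                        (sym (∑-distribʳ-* (allFin n) _ c))

distanceSum-≤ : ∀ (C : Code q n) k → ∣ C ∣ ≡ k * q →
                distanceSum (elements C) ≤ R C * (∣ C ∣ * ∣ C ∣ ∸ q * (k * k))
distanceSum-≤ {q} {n} C k m≡kq = begin
  distanceSum (elements C)
    ≡⟨ distanceSum-columns (elements C) ⟩
  ∑ (allFin n) (λ i → disagreements (λ x → lookup x i) (elements C))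
    ≤⟨ ∑-mono (allFin n) column ⟩
  ∑ (allFin n) (λ i → 𝟙 (¬? (constantAt? C i)) * K)
    ≡⟨ R-* C K ⟨
  R C * K ∎
  where
  open ≤-Reasoning
  -- Since `∣ C ∣` is `k * q`, the subtracted term is |C|²/q, written without division.
  K = ∣ C ∣ * ∣ C ∣ ∸ q * (k * k)

  column : ∀ i → disagreements (λ x → lookup x i) (elements C) ≤ 𝟙 (¬? (constantAt? C i)) * K
  column i with constantAt? C i
  ... | yes const = ≤-reflexive (disagreements-constant (λ x → lookup x i) (elements C) const)
  ... | no  _     = ≤-trans (disagreements-≤ (λ x → lookup x i) (elements C) k m≡kq)
                            (≤-reflexive (sym (*-identityˡ K)))

distanceSum-uniform : ∀ (C : Code q n) k → (∀ i → ¬ ConstantAt C i → ∀ b → occurrences C i b ≡ k) →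
                      distanceSum (elements C) ≡ R C * (∣ C ∣ * ∣ C ∣ ∸ q * (k * k))
distanceSum-uniform {q} {n} C k uniform = begin
  distanceSum (elements C)
    ≡⟨ distanceSum-columns (elements C) ⟩
  ∑ (allFin n) (λ i → disagreements (λ x → lookup x i) (elements C))
    ≡⟨ ∑-cong (allFin n) column ⟩
  ∑ (allFin n) (λ i → 𝟙 (¬? (constantAt? C i)) * K)
    ≡⟨ R-* C K ⟨
  R C * K ∎
  where
  open ≡-Reasoning
  K = ∣ C ∣ * ∣ C ∣ ∸ q * (k * k)

  column : ∀ i → disagreements (λ x → lookup x i) (elements C) ≡ 𝟙 (¬? (constantAt? C i)) * K
  column i with constantAt? C i
  ... | yes const  = disagreements-constant (λ x → lookup x i) (elements C) const
  ... | no  ¬const = trans (disagreements-uniform (λ x → lookup x i) (elements C) k (uniform i ¬const))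
                           (sym (*-identityˡ K))

-- Invariance of size and distance sum under isometry.

-- An isometry acts on words paired with membership proofs, so sums to be transported along it must
-- run over such pairs.
members : (C : Code q n) → List (Member C)
members C = mapWith∈ (elements C) (λ {x} x∈ → x , x∈)

map-proj₁-members : ∀ (C : Code q n) → map proj₁ (members C) ≡ elements C
map-proj₁-members C = trans (map-mapWith∈ (elements C) _ proj₁) (mapWith∈-id (elements C))

Member-≡ : ∀ (C : Code q n) {x y : Member C} → proj₁ x ≡ proj₁ y → x ≡ y
Member-≡ C {x , p} {.x , p′} refl = cong (x ,_) (unique⇒irrelevant (unique C) p p′)

-- Projecting `members C` gives back the enumeration, so some pair with the same word is listed; its
-- membership proof may be a different one, which `Member-≡` reconciles.
∈-members : ∀ (C : Code q n) (x : Member C) → x ∈ members C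
∈-members C (x , x∈)
  with y , y∈ , x≡y ← ∈-map⁻ proj₁ (subst (x ∈_) (sym (map-proj₁-members C)) x∈) =
  subst (_∈ members C) (sym (Member-≡ C x≡y)) y∈

∑-members : ∀ (C : Code q n) f → ∑ (elements C) f ≡ ∑ (members C) (f ∘ proj₁)
∑-members C f = trans (cong (λ ws → ∑ ws f) (sym (map-proj₁-members C))) (∑-map proj₁ (members C) f)

module _ {C D : Code q n} (iso : Isometric C D) where

  private
    φ = proj₁ iso
    open Bijection φ using (to; injective; strictlySurjective)

  -- Two duplicate-free lists with the same elements are permutations of each other. Injectivity
  -- makes the image list duplicate-free, and surjectivity makes it exhaust `D`.
  image-↭ : map (proj₁ ∘ to) (members C) ↭ elements D
  image-↭ = ∼bag⇒↭ (unique∧set⇒bag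
    -- `members C` has no repetitions because its list of first components has none.
    (Unique.map⁺ (injective ∘ Member-≡ D) (Unique.map⁻ (subst Unique (sym (map-proj₁-members C)) (unique C))))
    (unique D)
    (mk⇔ image⊆D D⊆image))
    where
    image⊆D : ∀ {z} → z ∈ map (proj₁ ∘ to) (members C) → z ∈ elements D
    image⊆D z∈ with x , _ , refl ← ∈-map⁻ (proj₁ ∘ to) z∈ = proj₂ (to x)

    D⊆image : ∀ {z} → z ∈ elements D → z ∈ map (proj₁ ∘ to) (members C)
    D⊆image z∈ with x , to-x≡z ← strictlySurjective (_ , z∈) =
      subst (_∈ map (proj₁ ∘ to) (members C)) (cong proj₁ to-x≡z) (∈-map⁺ (proj₁ ∘ to) (∈-members C x))

  isometric⇒∣∣≡ : ∣ D ∣ ≡ ∣ C ∣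
  isometric⇒∣∣≡ = begin
    ∣ D ∣                                 ≡⟨ ↭-length image-↭ ⟨
    length (map (proj₁ ∘ to) (members C)) ≡⟨ length-map _ (members C) ⟩
    length (members C)                    ≡⟨ length-map proj₁ (members C) ⟨
    length (map proj₁ (members C))        ≡⟨ cong length (map-proj₁-members C) ⟩
    ∣ C ∣                                 ∎
    where open ≡-Reasoning

  ∑-image : ∀ f → ∑ (elements D) f ≡ ∑ (members C) (f ∘ proj₁ ∘ to)
  ∑-image f = trans (sym (∑-↭ f image-↭)) (∑-map (proj₁ ∘ to) (members C) f)

  -- Both sums are pulled back to `members C`, where the isometry equates them pair by pair.
  isometric⇒distanceSum≡ : distanceSum (elements C) ≡ distanceSum (elements D)
  isometric⇒distanceSum≡ = begin
    distanceSum (elements C)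
      ≡⟨ ∑-members C _ ⟩
    (∑ (members C) λ x → ∑ (elements C) λ y → hamming (proj₁ x) y)
      ≡⟨ ∑-cong (members C) (λ x → ∑-members C _) ⟩
    (∑ (members C) λ x → ∑ (members C) λ y → hamming (proj₁ x) (proj₁ y))
      ≡⟨ ∑-cong (members C) (λ x → ∑-cong (members C) λ y → sym (proj₂ iso x y)) ⟩
    (∑ (members C) λ x → ∑ (members C) λ y → hamming (proj₁ (to x)) (proj₁ (to y)))
      ≡⟨ ∑-cong (members C) (λ x → sym (∑-image _)) ⟩
    (∑ (members C) λ x → ∑ (elements D) λ y → hamming (proj₁ (to x)) y)
      ≡⟨ ∑-image _ ⟨
    distanceSum (elements D) ∎
    where open ≡-Reasoning

-- The empty code, and cancellation of the common factor.

R-empty : ∀ (C : Code q n) → ∣ C ∣ ≡ 0 → R C ≡ 0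
R-empty {n = n} C ∣C∣≡0 = trans (length-filter-∑ (λ i → ¬? (constantAt? C i)) (allFin n))
  (∑-zero (All.universal (λ i → 𝟙-¬ (constantAt? C i) (constant (elements C) ∣C∣≡0)) (allFin n)))
  where
  constant : ∀ {P : Word _ n → Set} ws → length ws ≡ 0 → All P ws
  constant [] _ = []

mainTheorem2 : (n q : ℕ) → 2 ≤ n → 2 ≤ q →
    (A : Code q n) (q∣A : q ∣ ∣ A ∣) →
    UniformColumnDistribution A q∣A → MetricallyDense A
-- A zero quotient means that `A` is empty; the common factor would then be 0 and could not be
-- cancelled.
mainTheorem2 n q 2≤n 2≤q A (divides zero ∣A∣≡0) uniform B iso =
  subst (_≤ R B) (sym (R-empty A ∣A∣≡0)) z≤n
mainTheorem2 n q 2≤n 2≤q A (divides k@(suc _) ∣A∣≡kq) uniform B iso =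
  *-cancelʳ-≤ (R A) (R B) K {{>-nonZero (m<n⇒0<n∸m qk²<m²)}} (begin
    R A * K                                        ≡⟨ distanceSum-uniform A k uniform ⟨
    distanceSum (elements A)                       ≡⟨ isometric⇒distanceSum≡ {C = A} {D = B} iso ⟩
    distanceSum (elements B)                       ≤⟨ distanceSum-≤ B k (trans ∣B∣≡∣A∣ ∣A∣≡kq) ⟩
    R B * (∣ B ∣ * ∣ B ∣ ∸ q * (k * k))            ≡⟨ cong (λ m → R B * (m * m ∸ q * (k * k))) ∣B∣≡∣A∣ ⟩
    R B * K                                        ∎)
  where
  open ≤-Reasoning
  K = ∣ A ∣ * ∣ A ∣ ∸ q * (k * k)

  ∣B∣≡∣A∣ : ∣ B ∣ ≡ ∣ A ∣
  ∣B∣≡∣A∣ = isometric⇒∣∣≡ {C = A} {D = B} iso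

  square : ∀ q k → q * (k * k) * q ≡ k * q * (k * q)
  square = solve-∀

  qk²<m² : q * (k * k) < ∣ A ∣ * ∣ A ∣
  qk²<m² = begin-strict
    -- Strictness comes from `2 ≤ q`, applied to a non-zero number: `k` is a successor here and `q`
    -- is positive.
    q * (k * k)       <⟨ m<m*n (q * (k * k)) q {{m*n≢0 q (k * k) {{>-nonZero (<-trans z<s 2≤q)}}}} 2≤q ⟩
    q * (k * k) * q   ≡⟨ square q k ⟩
    k * q * (k * q)   ≡⟨ cong₂ _*_ ∣A∣≡kq ∣A∣≡kq ⟨
    ∣ A ∣ * ∣ A ∣     ∎
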